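{- The sets of patterns $\{112,1231\}$ and $\{121,1132\}$ are $m$-equivalent, that is, $\{112,1231\}\sim\{121,1132\}$.
   Context: A (finite, reduced) multiset is $S=1^{a_1}2^{a_2}\cdots k^{a_k}$ with $k\ge 1$ and all $a_i\ge 1$, meaning that $i$ occurs with multiplicity $a_i$. A multipermutation of $S$ is a word having exactly $a_i$ occurrences of each letter $i\in[k]=\{1,\dots,k\}$ and no other letters. A word $\pi=\pi_1\cdots\pi_n$ contains a pattern (word) $\rho=\rho_1\cdots\rho_\ell$ if there are indices $i(1)<\cdots<i(\ell)$ such that for all $a,b\in[\ell]$: $\pi_{i(a)}<\pi_{i(b)}$ iff $\rho_a<\rho_b$, and $\pi_{i(a)}>\pi_{i(b)}$ iff $\rho_a>\rho_b$; otherwise $\pi$ avoids $\rho$. For a set $P$ of patterns, $\mathrm{av}(S;P)$ is the number of multipermutations of $S$ that avoid every pattern in $P$. Two sets of patterns $P,Q$ are $m$-equivalent, written here $P\sim Q$, if $\mathrm{av}(S;P)=\mathrm{av}(S;Q)$ for every multiset $S$. -}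

module Defs where

open import Data.Nat using (ℕ; zero; suc; _≤_)
import Data.Nat as ℕ
open import Data.Fin using (Fin; _<_; _>_)
open import Data.Fin.Properties using (all?; any?; _<?_) renaming (_≟_ to _≟ᶠ_)
open import Data.Vec using (Vec; []; _∷_; lookup; sum; count)
open import Data.Vec.Properties using (∷-injective)
open import Data.List using (List; []; _∷_; [_]; allFin; cartesianProductWith; filter; length)
import Data.List as List
open import Data.List.Membership.Propositional using (_∈_)
open import Data.List.Membership.Propositional.Properties
  using (∈-allFin; ∈-cartesianProductWith⁺)
open import Data.List.Relation.Unary.All using (All; []; _∷_)
import Data.List.Relation.Unary.All as All
open import Data.List.Relation.Unary.Any using (here)
open import Data.List.Relation.Unary.Unique.Propositional using (Unique; []; _∷_)
open import Data.List.Relation.Unary.Unique.Propositional.Properties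
  using (allFin⁺; cartesianProductWith⁺)
open import Data.Product using (∃; _×_; _,_)
open import Function.Bundles using (_⇔_; mk⇔; Equivalence)
open import Relation.Binary.PropositionalEquality using (_≡_; refl)
open import Relation.Nullary using (¬_; Dec; ¬?; map′; _×-dec_; _→-dec_)
open import Relation.Unary using (Pred; Decidable)
open import Level using (0ℓ)

-- The multiset 1^{a₁} 2^{a₂} ⋯ k^{a_k}.  The letter i ∈ {1, …, k} is
-- represented by the element i − 1 of Fin k.
record Multiset : Set where
  field
    k     : ℕ
    1≤k   : 1 ≤ k
    mult  : Vec ℕ k
    1≤mult : ∀ i → 1 ≤ lookup mult i

  size : ℕ
  size = sum mult

Word : ℕ → ℕ → Set
Word k n = Vec (Fin k) n

-- Only the relative order of the letters of a pattern matters.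
Pattern : Set
Pattern = List ℕ

IsMultipermutation : (S : Multiset) → ∀ {n} → Word (Multiset.k S) n → Set
IsMultipermutation S π = ∀ i → count (i ≟ᶠ_) π ≡ lookup (Multiset.mult S) i

module _ {k n : ℕ} (π : Word k n) (ρ : Pattern) where

  -- The entries of the vector are the positions i(1), …, i(ℓ) in π.
  IsOccurrence : Vec (Fin n) (length ρ) → Set
  IsOccurrence i =
    (∀ a b → a < b → lookup i a < lookup i b) ×
    (∀ a b →
      (lookup π (lookup i a) < lookup π (lookup i b) ⇔ List.lookup ρ a ℕ.< List.lookup ρ b) ×
      (lookup π (lookup i a) > lookup π (lookup i b) ⇔ List.lookup ρ a ℕ.> List.lookup ρ b))

  Contains : Set
  Contains = ∃ IsOccurrence

  Avoids : Set
  Avoids = ¬ Contains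

AvoidsAll : ∀ {k n} → List Pattern → Word k n → Set
AvoidsAll P π = All (Avoids π) P

isMultipermutation? : ∀ S {n} → Decidable (IsMultipermutation S {n})
isMultipermutation? S π = all? λ i → count (i ≟ᶠ_) π ℕ.≟ lookup (Multiset.mult S) i

_⇔-dec_ : {A B : Set} → Dec A → Dec B → Dec (A ⇔ B)
a? ⇔-dec b? = map′ (λ (f , g) → mk⇔ f g)
                   (λ e → Equivalence.to e , Equivalence.from e)
                   ((a? →-dec b?) ×-dec (b? →-dec a?))

anyVec? : ∀ {n} m {P : Pred (Vec (Fin n) m) 0ℓ} → Decidable P → Dec (∃ P)
anyVec? zero    P? = map′ ([] ,_) (λ { ([] , p) → p }) (P? [])
anyVec? (suc m) P? =
  map′ (λ (x , xs , p) → x ∷ xs , p)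
       (λ { (x ∷ xs , p) → x , xs , p })
       (any? λ x → anyVec? m λ xs → P? (x ∷ xs))

module _ {k n : ℕ} (π : Word k n) (ρ : Pattern) where

  isOccurrence? : Decidable (IsOccurrence π ρ)
  isOccurrence? i =
    (all? λ a → all? λ b → (a <? b) →-dec (lookup i a <? lookup i b)) ×-dec
    (all? λ a → all? λ b →
      ((lookup π (lookup i a) <? lookup π (lookup i b))
        ⇔-dec (List.lookup ρ a ℕ.<? List.lookup ρ b)) ×-dec
      ((lookup π (lookup i b) <? lookup π (lookup i a))
        ⇔-dec (List.lookup ρ b ℕ.<? List.lookup ρ a)))

  avoids? : Dec (Avoids π ρ)
  avoids? = ¬? (anyVec? (length ρ) isOccurrence?)

avoidsAll? : ∀ {k n} (P : List Pattern) → Decidable (AvoidsAll {k} {n} P)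
avoidsAll? P π = All.all? (avoids? π) P

allWords : ∀ k n → List (Word k n)
allWords k zero    = [ [] ]
allWords k (suc n) = cartesianProductWith _∷_ (allFin k) (allWords k n)

-- By the next two lemmas allWords lists every word exactly once, so the
-- length of a filtered sublist is a cardinality.
∈-allWords : ∀ {k n} (π : Word k n) → π ∈ allWords k n
∈-allWords []      = here refl
∈-allWords (x ∷ π) = ∈-cartesianProductWith⁺ _∷_ (∈-allFin x) (∈-allWords π)

allWords-unique : ∀ k n → Unique (allWords k n)
allWords-unique k zero    = [] ∷ []
allWords-unique k (suc n) =
  cartesianProductWith⁺ _∷_ ∷-injective (allFin⁺ k) (allWords-unique k n)

-- A multipermutation of S necessarily has length a₁ + ⋯ + a_k, so it is
-- enough to search the words of that length.
avoidingMultipermutations : (S : Multiset) → List Pattern →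
                            List (Word (Multiset.k S) (Multiset.size S))
avoidingMultipermutations S P =
  filter (avoidsAll? P)
    (filter (isMultipermutation? S) (allWords (Multiset.k S) (Multiset.size S)))

av : Multiset → List Pattern → ℕ
av S P = length (avoidingMultipermutations S P)

infix 4 _∼_

-- m-equivalence.  A finite set of patterns is given by a list of its
-- elements; av depends only on membership in that list.
_∼_ : List Pattern → List Pattern → Set
P ∼ Q = ∀ S → av S P ≡ av S Q

{-# OPTIONS --safe #-}
module Submission where

-- Delete the smallest letter, of multiplicity a, from a word avoiding
-- {112, 1231}: the word is A 1 B 1^(a-1), where B is weakly decreasing if a ≥ 2,
-- and every such way of inserting the 1s into an avoiding word AB is allowed.
-- For {121, 1132} the same holds with A 1^a B and B weakly increasing.  If AB has
-- length n and its longest weakly decreasing (respectively increasing) suffix has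
-- length l, then in both cases the suffix lengths after insertion are
-- a, a+1, …, a+l, together with n - l further copies of l when a = 1.  So the two
-- generating trees agree.

open import Data.Fin using (Fin; zero; suc; _<_; _≥_)
import Data.Fin as Fin
import Data.Fin.Properties as Fin
open import Data.List using (List; []; _∷_; _++_; length; map; filter; replicate; concatMap;
  downFrom)
import Data.List as List
import Data.List.Properties as List
open import Data.List.Membership.Propositional using (_∈_; find; lose)
open import Data.List.Membership.Propositional.Properties
  using (∈-lookup; ∈-map⁺; ∈-map⁻; ∈-filter⁺; ∈-filter⁻; ∈-concatMap⁺; ∈-concatMap⁻)
open import Data.List.Membership.Propositional.Properties.WithK using (unique∧set⇒bag)
open import Data.List.Relation.Binary.BagAndSetEquality using (∼bag⇒↭)
open import Data.List.Relation.Binary.Permutation.Propositional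
  using (_↭_; prep; swap; ↭-reflexive; ↭-sym; ↭-trans)
import Data.List.Relation.Binary.Permutation.Propositional as ↭ using (refl; trans)
import Data.List.Relation.Binary.Permutation.Propositional.Properties as ↭
open import Data.List.Relation.Binary.Sublist.Propositional
  using (_⊆_; []; _∷_; _∷ʳ_; minimum; ⊆-trans; from∈; to∈)
import Data.List.Relation.Binary.Sublist.Propositional.Properties as ⊆
open import Data.List.Relation.Unary.All using (All; []; _∷_)
import Data.List.Relation.Unary.All as All
import Data.List.Relation.Unary.All.Properties as All using (replicate⁺)
open import Data.List.Relation.Unary.AllPairs using (AllPairs; []; _∷_; allPairs?)
import Data.List.Relation.Unary.AllPairs as AllPairs using (map)
import Data.List.Relation.Unary.AllPairs.Properties as AllPairs using (map⁺; ++⁺)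
open import Data.List.Relation.Unary.Any using (here; there)
open import Data.List.Relation.Unary.Unique.Propositional using (Unique)
import Data.List.Relation.Unary.Unique.Propositional.Properties as Unique
open import Data.Nat using (ℕ; zero; suc; _+_; _≤_; z≤n; s≤s; z<s; s<s; s<s⁻¹)
import Data.Nat as ℕ
import Data.Nat.Properties as ℕ
open import Data.Product using (∃; _×_; _,_; proj₁; proj₂)
open import Data.Sum using (_⊎_; inj₁; inj₂)
open import Data.Vec using (Vec; []; _∷_; lookup; toList; sum)
import Data.Vec as Vec
import Data.Vec.Properties as Vec
open import Function using (_∘_; case_of_)
open import Function.Bundles using (_⇔_; mk⇔; Equivalence)
open import Level using (0ℓ)
open import Relation.Binary.Core using (Rel)
open import Relation.Binary.Definitions as B using (tri<; tri≈; tri>)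
open import Relation.Binary.PropositionalEquality
open import Relation.Nullary using (¬_; Dec; yes; no; contradiction; _⊎-dec_)
open import Relation.Nullary.Decidable using (from-yes; toSum; _×-dec_)
open import Defs

-- All four patterns begin with their smallest letter and repeat it. A 1 can play no other letter,
-- so an occurrence that uses a 1 begins at a 1 and has its remaining letters after the first 1;
-- every other occurrence already lies in AB. Hence the conditions on an insertion concern only the
-- part after the first 1: 112 (respectively 121) fixes the places of the later 1s, and 1231
-- (respectively 1132) comes into force only with a second 1, when it forbids an ascent
-- (respectively a descent) in B.
--
-- The same position does not give the same suffix length on both sides. In A 1^a B with B sorted
-- the length is a+|B|. In A 1 B 1^(a-1) a nonempty B cuts off the first 1, which leaves a-1+|B| for
-- sorted B, while the empty B gives a+l. The values a, ..., a+l thus appear in cyclically shifted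
-- order, and the children of a node agree as multisets of labels only. This is why the comparison
-- is made with permutations of label lists.

private variable
  A B : Set
  k n m : ℕ

-- Occurrences of a pattern as order-preserving sublists

Increasing : Vec (Fin n) m → Set
Increasing i = ∀ a b → a < b → lookup i a < lookup i b

-- In an increasing vector all positions after the first entry are positive, so they are positions
-- in the tail of the word. This drives the induction along the word.
positive⇒map-suc : (i : Vec (Fin (suc n)) m) → (∀ a → zero {n} < lookup i a) →
                   ∃ λ j → i ≡ Vec.map suc j
positive⇒map-suc [] _ = [] , refl
positive⇒map-suc (zero ∷ i) pos = contradiction (pos zero) ℕ.n≮0
positive⇒map-suc (suc x ∷ i) pos with j , refl ← positive⇒map-suc i (pos ∘ suc) = x ∷ j , refl

increasing-pred : (j : Vec (Fin n) m) → Increasing (Vec.map suc j) → Increasing j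
increasing-pred j inc a b a<b =
  s<s⁻¹ (subst₂ _<_ (Vec.lookup-map a suc j) (Vec.lookup-map b suc j) (inc a b a<b))

increasing-suc : (j : Vec (Fin n) m) → Increasing j → Increasing (Vec.map suc j)
increasing-suc j inc a b a<b =
  subst₂ _<_ (sym (Vec.lookup-map a suc j)) (sym (Vec.lookup-map b suc j)) (s<s (inc a b a<b))

select : Vec A n → Vec (Fin n) m → Vec A m
select π i = Vec.map (lookup π) i

select-suc : ∀ (x : A) (π : Vec A n) (j : Vec (Fin n) m) →
             select (x ∷ π) (Vec.map suc j) ≡ select π j
select-suc x π j = sym (Vec.map-∘ (lookup (x ∷ π)) suc j)

select-⊆ : (π : Vec A n) (i : Vec (Fin n) m) → Increasing i →
           toList (select π i) ⊆ toList π
select-⊆ [] [] inc = []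
select-⊆ (x ∷ π) [] inc = minimum _
select-⊆ (x ∷ π) (zero ∷ i) inc
  with j , refl ← positive⇒map-suc i (λ a → inc zero (suc a) z<s)
  = refl ∷ subst (λ ys → toList ys ⊆ toList π) (sym (select-suc x π j))
      (select-⊆ π j (increasing-pred j λ a b a<b → inc (suc a) (suc b) (s<s a<b)))
select-⊆ (x ∷ π) (suc y ∷ i) inc
  with j , refl ← positive⇒map-suc i (λ a → ℕ.<-trans z<s (inc zero (suc a) z<s))
  = x ∷ʳ subst (λ ys → toList ys ⊆ toList π) (sym (select-suc x π (y ∷ j)))
      (select-⊆ π (y ∷ j) (increasing-pred (y ∷ j) inc))

⊆-select : (π : Vec A n) (ys : Vec A m) → toList ys ⊆ toList π →
           ∃ λ i → Increasing i × select π i ≡ ys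
⊆-select [] [] [] = [] , (λ ()) , refl
⊆-select (x ∷ π) [] (_ ∷ʳ τ) = [] , (λ ()) , refl
⊆-select (x ∷ π) (y ∷ ys) (_ ∷ʳ τ) with i , inc , eq ← ⊆-select π (y ∷ ys) τ
  = Vec.map suc i , increasing-suc i inc , trans (select-suc x π i) eq
⊆-select {n = suc n} (x ∷ π) (.x ∷ ys) (refl ∷ τ) with i , inc , eq ← ⊆-select π ys τ
  = zero ∷ Vec.map suc i , inc′ , cong (x ∷_) (trans (select-suc x π i) eq)
  where
  inc′ : Increasing (zero ∷ Vec.map suc i)
  inc′ zero    (suc b) _   = subst (zero {n} <_) (sym (Vec.lookup-map b suc i)) z<s
  inc′ (suc a) (suc b) a<b = increasing-suc i inc a b (s<s⁻¹ a<b)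

-- Only the implications from the pattern to the word are recorded. The letters of the pattern are
-- linearly ordered, so trichotomy gives the converses that an occurrence demands.
record OrderPreserving (ρ : Pattern) (y : Fin (length ρ) → Fin k) : Set where
  field
    pres-< : ∀ a b → List.lookup ρ a ℕ.< List.lookup ρ b → y a < y b
    pres-≡ : ∀ a b → List.lookup ρ a ≡ List.lookup ρ b → y a ≡ y b

module _ {k n} (π : Word k n) (ρ : Pattern) where
  contains⇒⊆ : Contains π ρ →
    ∃ λ ys → OrderPreserving ρ (lookup ys) × toList ys ⊆ toList π
  contains⇒⊆ (i , inc , iso) = select π i , pres , select-⊆ π i inc
    where
    eq : ∀ a → lookup (select π i) a ≡ lookup π (lookup i a)
    eq a = Vec.lookup-map a (lookup π) i

    pres : OrderPreserving ρ (lookup (select π i))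
    pres .OrderPreserving.pres-< a b ra<rb = subst₂ _<_ (sym (eq a)) (sym (eq b))
      (Equivalence.from (proj₁ (iso a b)) ra<rb)
    pres .OrderPreserving.pres-≡ a b ra≡rb
      with Fin.<-cmp (lookup π (lookup i a)) (lookup π (lookup i b))
    ... | tri< lt _ _ = contradiction (Equivalence.to (proj₁ (iso a b)) lt) (ℕ.<-irrefl ra≡rb)
    ... | tri≈ _ e _  = trans (eq a) (trans e (sym (eq b)))
    ... | tri> _ _ gt = contradiction (Equivalence.to (proj₂ (iso a b)) gt) (ℕ.<-irrefl (sym ra≡rb))

  ⊆⇒contains : ∀ ys → OrderPreserving ρ (lookup ys) → toList ys ⊆ toList π → Contains π ρ
  ⊆⇒contains ys pres τ with i , inc , refl ← ⊆-select π ys τ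
    = i , inc , λ a b → mk⇔ (refl-< a b) (pres-<′ a b) , mk⇔ (refl-< b a) (pres-<′ b a)
    where
    open OrderPreserving pres
    eq : ∀ a → lookup (select π i) a ≡ lookup π (lookup i a)
    eq a = Vec.lookup-map a (lookup π) i

    pres-<′ : ∀ a b → List.lookup ρ a ℕ.< List.lookup ρ b →
              lookup π (lookup i a) < lookup π (lookup i b)
    pres-<′ a b = subst₂ _<_ (eq a) (eq b) ∘ pres-< a b

    refl-< : ∀ a b → lookup π (lookup i a) < lookup π (lookup i b) →
             List.lookup ρ a ℕ.< List.lookup ρ b
    refl-< a b lt with ℕ.<-cmp (List.lookup ρ a) (List.lookup ρ b)
    ... | tri< r _ _ = r
    ... | tri≈ _ r _ = contradiction lt
      (ℕ.<-irrefl (cong Fin.toℕ (trans (sym (eq a)) (trans (pres-≡ a b r) (eq b)))))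
    ... | tri> _ _ r = contradiction lt (ℕ.<-asym (pres-<′ b a r))

-- The four patterns as conditions on sublists

IncreasingOn : ℕ → (ℕ → Fin k) → Set
IncreasingOn ℓ f = ∀ {r s} → 1 ≤ r → r ℕ.< s → s ≤ ℓ → f r < f s

Letters : ℕ → Pattern → Set
Letters ℓ = All λ r → 1 ≤ r × r ≤ ℓ

spelling : (f : ℕ → Fin k) (ρ : Pattern) → Vec (Fin k) (length ρ)
spelling f ρ = Vec.map f (Vec.fromList ρ)

lookup-spelling : (f : ℕ → Fin k) (ρ : Pattern) →
                  ∀ a → lookup (spelling f ρ) a ≡ f (List.lookup ρ a)
lookup-spelling f (r ∷ ρ) zero    = refl
lookup-spelling f (r ∷ ρ) (suc a) = lookup-spelling f ρ a

spelling-preserves : ∀ {ℓ} {f : ℕ → Fin k} {ρ} → IncreasingOn ℓ f → Letters ℓ ρ →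
                     OrderPreserving ρ (lookup (spelling f ρ))
spelling-preserves {f = f} {ρ} inc in-range = record
  { pres-< = λ a b r<s → subst₂ _<_ (sym (lookup-spelling f ρ a)) (sym (lookup-spelling f ρ b))
      (inc (proj₁ (All.lookup in-range (∈-lookup a))) r<s
           (proj₂ (All.lookup in-range (∈-lookup b))))
  ; pres-≡ = λ a b r≡s →
      trans (lookup-spelling f ρ a) (trans (cong f r≡s) (sym (lookup-spelling f ρ b)))
  }

letters? : ∀ ℓ (ρ : Pattern) → Dec (Letters ℓ ρ)
letters? ℓ ρ = All.all? (λ r → (1 ℕ.≤? r) ×-dec (r ℕ.≤? ℓ)) ρ

module _ (x y z : Fin k) where
  assign : ℕ → Fin k
  -- Pattern letters start at 1. The value at 0, like those beyond 3, is a default on which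
  -- `IncreasingOn` imposes nothing.
  assign 0 = x
  assign 1 = x
  assign 2 = y
  assign (suc (suc (suc _))) = z

  assign-increasing₂ : x < y → IncreasingOn 2 assign
  assign-increasing₂ x<y {1}           {2}                 _ _         _ = x<y
  assign-increasing₂ x<y {1}           {1}                 _ (s<s ())  _
  assign-increasing₂ x<y {suc (suc r)} {suc zero}          _ (s≤s ())  _
  assign-increasing₂ x<y {suc (suc r)} {suc (suc zero)}    _ (s≤s (s≤s ())) _
  assign-increasing₂ x<y {_}           {suc (suc (suc _))} _ _ (s≤s (s≤s ()))

  assign-increasing₃ : x < y → y < z → IncreasingOn 3 assign
  assign-increasing₃ x<y y<z {_} {suc (suc (suc (suc _)))} _ _ (s≤s (s≤s (s≤s ())))
  assign-increasing₃ x<y y<z {1} {1} _ (s<s ()) _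
  assign-increasing₃ x<y y<z {1} {2} _ _ _ = x<y
  assign-increasing₃ x<y y<z {1} {3} _ _ _ = Fin.<-trans x<y y<z
  assign-increasing₃ x<y y<z {2} {1} _ (s≤s ()) _
  assign-increasing₃ x<y y<z {2} {2} _ (s≤s (s≤s ())) _
  assign-increasing₃ x<y y<z {2} {3} _ _ _ = y<z
  assign-increasing₃ x<y y<z {suc (suc (suc r))} {1} _ (s≤s ()) _
  assign-increasing₃ x<y y<z {suc (suc (suc r))} {2} _ (s≤s (s≤s ())) _
  assign-increasing₃ x<y y<z {suc (suc (suc r))} {3} _ (s≤s (s≤s (s≤s ()))) _

p112 p1231 p121 p1132 : Pattern
p112  = 1 ∷ 1 ∷ 2 ∷ []
p1231 = 1 ∷ 2 ∷ 3 ∷ 1 ∷ []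
p121  = 1 ∷ 2 ∷ 1 ∷ []
p1132 = 1 ∷ 1 ∷ 3 ∷ 2 ∷ []

Avoid112 Avoid1231 Avoid121 Avoid1132 : List (Fin k) → Set
Avoid112  w = ∀ {x y} → x < y → ¬ (x ∷ x ∷ y ∷ [] ⊆ w)
Avoid121  w = ∀ {x y} → x < y → ¬ (x ∷ y ∷ x ∷ [] ⊆ w)
Avoid1231 w = ∀ {x y z} → x < y → y < z → ¬ (x ∷ y ∷ z ∷ x ∷ [] ⊆ w)
Avoid1132 w = ∀ {x y z} → x < y → y < z → ¬ (x ∷ x ∷ z ∷ y ∷ [] ⊆ w)

module _ (π : Word k n) where
  open OrderPreserving

  avoids112 : Avoids π p112 ⇔ Avoid112 (toList π)
  avoids112 = mk⇔
    (λ av {x} {y} x<y τ → av (⊆⇒contains π p112 _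
      (spelling-preserves (assign-increasing₂ x y y x<y) (from-yes (letters? 2 p112))) τ))
    λ av c → case contains⇒⊆ π p112 c of λ where
      (x ∷ x′ ∷ y ∷ [] , pres , τ) →
        av (pres-< pres zero (suc (suc zero)) (s<s z<s))
         (subst (λ u → x ∷ u ∷ y ∷ [] ⊆ toList π) (pres-≡ pres (suc zero) zero refl) τ)

  avoids121 : Avoids π p121 ⇔ Avoid121 (toList π)
  avoids121 = mk⇔
    (λ av {x} {y} x<y τ → av (⊆⇒contains π p121 _
      (spelling-preserves (assign-increasing₂ x y y x<y) (from-yes (letters? 2 p121))) τ))
    λ av c → case contains⇒⊆ π p121 c of λ where
      (x ∷ y ∷ x′ ∷ [] , pres , τ) →
        av (pres-< pres zero (suc zero) (s<s z<s))
         (subst (λ u → x ∷ y ∷ u ∷ [] ⊆ toList π) (pres-≡ pres (suc (suc zero)) zero refl) τ)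

  avoids1231 : Avoids π p1231 ⇔ Avoid1231 (toList π)
  avoids1231 = mk⇔
    (λ av {x} {y} {z} x<y y<z τ → av (⊆⇒contains π p1231 _
      (spelling-preserves (assign-increasing₃ x y z x<y y<z) (from-yes (letters? 3 p1231))) τ))
    λ av c → case contains⇒⊆ π p1231 c of λ where
      (x ∷ y ∷ z ∷ x′ ∷ [] , pres , τ) →
        av (pres-< pres zero (suc zero) (s<s z<s))
         (pres-< pres (suc zero) (suc (suc zero)) (s<s (s<s z<s)))
         (subst (λ u → x ∷ y ∷ z ∷ u ∷ [] ⊆ toList π)
           (pres-≡ pres (suc (suc (suc zero))) zero refl) τ)

  avoids1132 : Avoids π p1132 ⇔ Avoid1132 (toList π)
  avoids1132 = mk⇔
    (λ av {x} {y} {z} x<y y<z τ → av (⊆⇒contains π p1132 _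
      (spelling-preserves (assign-increasing₃ x y z x<y y<z) (from-yes (letters? 3 p1132))) τ))
    λ av c → case contains⇒⊆ π p1132 c of λ where
      (x ∷ x′ ∷ z ∷ y ∷ [] , pres , τ) →
        av (pres-< pres zero (suc (suc (suc zero))) (s<s z<s))
         (pres-< pres (suc (suc (suc zero))) (suc (suc zero)) (s<s (s<s z<s)))
         (subst (λ u → x ∷ u ∷ z ∷ y ∷ [] ⊆ toList π) (pres-≡ pres (suc zero) zero refl) τ)

-- Deleting the smallest letter, and the content of a word

occ : Fin k → List (Fin k) → ℕ
occ i w = length (filter (i Fin.≟_) w)

count≡occ : (i : Fin k) (π : Vec (Fin k) n) → Vec.count (i Fin.≟_) π ≡ occ i (toList π)
count≡occ i []      = refl
count≡occ i (x ∷ π) with i Fin.≟ x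
... | yes _ = cong suc (count≡occ i π)
... | no  _ = count≡occ i π

delete : List (Fin (suc k)) → List (Fin k)
delete []          = []
delete (zero ∷ w)  = delete w
delete (suc x ∷ w) = x ∷ delete w

zeros : List (Fin (suc k)) → ℕ
zeros = occ zero

occ-delete : (i : Fin k) (w : List (Fin (suc k))) → occ (suc i) w ≡ occ i (delete w)
occ-delete i []          = refl
occ-delete i (zero ∷ w)  = occ-delete i w
occ-delete i (suc x ∷ w) with i Fin.≟ x
... | yes _ = cong suc (occ-delete i w)
... | no  _ = occ-delete i w

delete-⊆⁺ : ∀ ys {w : List (Fin (suc k))} → map suc ys ⊆ w → ys ⊆ delete w
delete-⊆⁺ []       τ = minimum _
delete-⊆⁺ (y ∷ ys) (zero ∷ʳ τ)  = delete-⊆⁺ (y ∷ ys) τ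
delete-⊆⁺ (y ∷ ys) (suc x ∷ʳ τ) = x ∷ʳ delete-⊆⁺ (y ∷ ys) τ
delete-⊆⁺ (y ∷ ys) (refl ∷ τ)   = refl ∷ delete-⊆⁺ ys τ

delete-⊆⁻ : ∀ {ys} (w : List (Fin (suc k))) → ys ⊆ delete w → map suc ys ⊆ w
delete-⊆⁻ []          []         = []
delete-⊆⁻ (zero ∷ w)  τ          = zero ∷ʳ delete-⊆⁻ w τ
delete-⊆⁻ (suc x ∷ w) (.x ∷ʳ τ)  = suc x ∷ʳ delete-⊆⁻ w τ
delete-⊆⁻ (suc x ∷ w) (refl ∷ τ) = refl ∷ delete-⊆⁻ w τ

delete-map-suc : (v : List (Fin k)) → delete (map suc v) ≡ v
delete-map-suc []      = refl
delete-map-suc (x ∷ v) = cong (x ∷_) (delete-map-suc v)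

zeros-map-suc : (v : List (Fin k)) → zeros (map suc v) ≡ 0
zeros-map-suc []      = refl
zeros-map-suc (x ∷ v) = zeros-map-suc v

length-delete : (w : List (Fin (suc k))) → length w ≡ zeros w + length (delete w)
length-delete []          = refl
length-delete (zero ∷ w)  = cong suc (length-delete w)
length-delete (suc x ∷ w) = trans (cong suc (length-delete w)) (sym (ℕ.+-suc (zeros w) _))

HasContent : Vec ℕ k → List (Fin k) → Set
HasContent m w = ∀ i → occ i w ≡ lookup m i

content-length : (m : Vec ℕ k) (w : List (Fin k)) → HasContent m w → length w ≡ sum m
content-length []      [] c = refl
content-length (a ∷ m) w  c = trans (length-delete w)
  (cong₂ _+_ (c zero) (content-length m (delete w) λ i → trans (sym (occ-delete i w)) (c (suc i))))

-- Generating words by inserting the smallest letter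

prependIf : ∀ {P : Set} → Dec P → A → List A → List A
prependIf (yes _) x xs = x ∷ xs
prependIf (no  _) x xs = xs

module _ {P : Set} {x : A} {xs : List A} where
  ∈-prependIf⁻ : ∀ {y} (d : Dec P) → y ∈ prependIf d x xs → (P × y ≡ x) ⊎ y ∈ xs
  ∈-prependIf⁻ (yes p) (here e)  = inj₁ (p , e)
  ∈-prependIf⁻ (yes p) (there h) = inj₂ h
  ∈-prependIf⁻ (no _)  h         = inj₂ h

  ∈-prependIf⁺ˡ : (d : Dec P) → P → x ∈ prependIf d x xs
  ∈-prependIf⁺ˡ (yes _) p = here refl
  ∈-prependIf⁺ˡ (no ¬p) p = contradiction p ¬p

  ∈-prependIf⁺ʳ : ∀ {y} (d : Dec P) → y ∈ xs → y ∈ prependIf d x xs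
  ∈-prependIf⁺ʳ (yes _) h = there h
  ∈-prependIf⁺ʳ (no _)  h = h

unique-prependIf : ∀ {P : Set} {x : A} {xs} (d : Dec P) →
                   All (x ≢_) xs → Unique xs → Unique (prependIf d x xs)
unique-prependIf (yes _) x∉ u = x∉ ∷ u
unique-prependIf (no _)  x∉ u = u

-- A child determines its parent through `g`, so lists `f x` for different `x` are disjoint. In the
-- generating tree `g` is `delete`.
concatMap-unique : ∀ {B : Set} (f : A → List B) (g : B → A) →
                   (∀ {x y} → y ∈ f x → g y ≡ x) → (∀ x → Unique (f x)) →
                   ∀ {xs} → Unique xs → Unique (concatMap f xs)
concatMap-unique f g g∘f uf []            = []
concatMap-unique f g g∘f uf {x ∷ xs} (x∉ ∷ u) =
  Unique.++⁺ (uf x) (concatMap-unique f g g∘f uf u) λ (y∈fx , y∈fxs) →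
    let z , z∈xs , y∈fz = find (∈-concatMap⁻ f {xs = xs} y∈fxs) in
    All.lookup x∉ z∈xs (trans (sym (g∘f y∈fx)) (g∘f y∈fz))

-- `glue a v` is the part after the first zero of an inserted word: the letters
-- of v together with a further zeros.
module Insertion
  (R : ∀ {k} → Rel (Fin k) 0ℓ) (R? : ∀ {k} → B.Decidable (R {k}))
  (glue : ∀ {k} → ℕ → List (Fin k) → List (Fin (suc k)))
  (delete-glue : ∀ {k} a (v : List (Fin k)) → delete (glue a v) ≡ v)
  (zeros-glue : ∀ {k} a (v : List (Fin k)) → zeros (glue a v) ≡ a)
  where

  -- `a` counts the zeros beyond the first, one less than the multiplicity, and `v` is the part B
  -- after the first zero. With a single zero B is arbitrary.
  Insertable : ℕ → List (Fin k) → Set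
  Insertable a v = a ≡ 0 ⊎ AllPairs R v

  insertable? : ∀ a (v : List (Fin k)) → Dec (Insertable a v)
  insertable? a v = a ℕ.≟ 0 ⊎-dec allPairs? R? v

  data Inserted (a : ℕ) : List (Fin k) → List (Fin (suc k)) → Set where
    here  : ∀ {v : List (Fin k)} → Insertable a v → Inserted a v (zero ∷ glue a v)
    there : ∀ {x : Fin k} {v w} → Inserted a v w → Inserted a (x ∷ v) (suc x ∷ w)

  insertions : ℕ → List (Fin k) → List (List (Fin (suc k)))
  -- The empty B is sorted, so this insertion needs no test.
  insertions a []      = (zero ∷ glue a []) ∷ []
  insertions a (x ∷ v) =
    prependIf (insertable? a (x ∷ v)) (zero ∷ glue a (x ∷ v)) (map (suc x ∷_) (insertions a v))

  ∈-insertions⁻ : ∀ a (v : List (Fin k)) {w} → w ∈ insertions a v → Inserted a v w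
  ∈-insertions⁻ a [] (here refl) = here (inj₂ [])
  ∈-insertions⁻ a (x ∷ v) h with ∈-prependIf⁻ (insertable? a (x ∷ v)) h
  ... | inj₁ (p , refl) = here p
  ... | inj₂ h′ with w , w∈ , refl ← ∈-map⁻ (suc x ∷_) h′ = there (∈-insertions⁻ a v w∈)

  ∈-insertions⁺ : ∀ {a} {v : List (Fin k)} {w} → Inserted a v w → w ∈ insertions a v
  ∈-insertions⁺ {a = a} (here {v = []} p)    = here refl
  ∈-insertions⁺ {a = a} (here {v = x ∷ v} p) = ∈-prependIf⁺ˡ (insertable? a (x ∷ v)) p
  ∈-insertions⁺ {a = a} (there {x = x} {v = v} i) =
    ∈-prependIf⁺ʳ (insertable? a (x ∷ v)) (∈-map⁺ (suc x ∷_) (∈-insertions⁺ i))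

  insertions-unique : ∀ a (v : List (Fin k)) → Unique (insertions a v)
  insertions-unique a []      = [] ∷ []
  insertions-unique a (x ∷ v) = unique-prependIf (insertable? a (x ∷ v))
    (All.tabulate λ h → case ∈-map⁻ (suc x ∷_) h of λ { (_ , _ , refl) () })
    (Unique.map⁺ List.∷-injectiveʳ (insertions-unique a v))

  inserted-delete : ∀ {a} {v : List (Fin k)} {w} → Inserted a v w → delete w ≡ v
  inserted-delete (here _)  = delete-glue _ _
  inserted-delete (there i) = cong (_ ∷_) (inserted-delete i)

  inserted-zeros : ∀ {a} {v : List (Fin k)} {w} → Inserted a v w → zeros w ≡ suc a
  inserted-zeros (here _)  = cong suc (zeros-glue _ _)
  inserted-zeros (there i) = inserted-zeros i

  -- Whichever zero the sublist starts with, its other letters come after the first zero. As each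
  -- forbidden pattern begins with its smallest letter, this covers every occurrence in which a zero
  -- takes part.
  after-first-zero : ∀ {a} {v : List (Fin k)} {w ys} → Inserted a v w → zero ∷ ys ⊆ w →
                     ∃ λ u → Insertable a u × ys ⊆ glue a u
  after-first-zero (here p)  (_ ∷ʳ τ)   = _ , p , ⊆.∷ˡ⁻ τ
  after-first-zero (here p)  (refl ∷ τ) = _ , p , τ
  after-first-zero (there i) (_ ∷ʳ τ)   = after-first-zero i τ

  -- Every multiplicity is meant to be positive: pred treats 0 like 1.
  generate : Vec ℕ k → List (List (Fin k))
  generate []      = [] ∷ []
  generate (a ∷ m) = concatMap (insertions (ℕ.pred a)) (generate m)

  generate-unique : (m : Vec ℕ k) → Unique (generate m)
  generate-unique []      = [] ∷ []
  generate-unique (a ∷ m) = concatMap-unique (insertions (ℕ.pred a)) delete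
    (λ {v} h → inserted-delete (∈-insertions⁻ _ v h)) (insertions-unique (ℕ.pred a))
    (generate-unique m)

  module Enumeration
    (Avoid : ∀ {k} → List (Fin k) → Set)
    (avoid-[] : Avoid {0} [])
    (avoid-delete : ∀ {k} {w : List (Fin (suc k))} → Avoid w → Avoid (delete w))
    (avoid⇒inserted : ∀ {k a} {w : List (Fin (suc k))} →
                      Avoid w → zeros w ≡ suc a → Inserted a (delete w) w)
    (inserted⇒avoid : ∀ {k a v} {w : List (Fin (suc k))} →
                      Avoid v → Inserted a v w → Avoid w)
    where

    ∈-generate⁻ : (m : Vec ℕ k) → (∀ i → 1 ≤ lookup m i) → ∀ {w} → w ∈ generate m →
                  Avoid w × HasContent m w
    ∈-generate⁻ [] pos (here refl) = avoid-[] , λ ()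
    ∈-generate⁻ (zero ∷ m) pos h = contradiction (pos zero) λ ()
    ∈-generate⁻ (suc a ∷ m) pos {w} h
      with v , v∈ , w∈ ← find (∈-concatMap⁻ (insertions a) {xs = generate m} h)
      with i ← ∈-insertions⁻ a v w∈
      with av , c ← ∈-generate⁻ m (pos ∘ suc) v∈
      = inserted⇒avoid av i , λ where
          zero    → inserted-zeros i
          (suc j) → trans (occ-delete j w) (trans (cong (occ j) (inserted-delete i)) (c j))

    ∈-generate⁺ : (m : Vec ℕ k) → (∀ i → 1 ≤ lookup m i) → ∀ {w} →
                  Avoid w → HasContent m w → w ∈ generate m
    ∈-generate⁺ [] pos {[]} av c = here refl
    ∈-generate⁺ (zero ∷ m) pos av c = contradiction (pos zero) λ ()
    ∈-generate⁺ (suc a ∷ m) pos {w} av c = ∈-concatMap⁺ (insertions a) (lose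
      (∈-generate⁺ m (pos ∘ suc) (avoid-delete av)
        λ j → trans (sym (occ-delete j w)) (c (suc j)))
      (∈-insertions⁺ (avoid⇒inserted av (c zero))))

    -- Read as lists of letters, the avoiding multipermutations and the generated words have the
    -- same members, and neither list repeats one. They are therefore permutations of each other.
    av≡length-generate : (P : List Pattern) →
      (∀ {k n} (π : Word k n) → AvoidsAll P π ⇔ Avoid (toList π)) →
      (S : Multiset) → av S P ≡ length (generate (Multiset.mult S))
    av≡length-generate P avoids⇔ S = trans (sym (List.length-map toList words))
      (↭.↭-length (∼bag⇒↭ (unique∧set⇒bag
        (Unique.map⁺ (λ {π} {σ} → toList-inj π σ)
          (Unique.filter⁺ (avoidsAll? P) (Unique.filter⁺ (isMultipermutation? S)
            (allWords-unique (Multiset.k S) size))))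
        (generate-unique mult)
        (mk⇔ to from))))
      where
      open Multiset S using (mult; 1≤mult; size)
      words = avoidingMultipermutations S P

      toList-inj : (π σ : Word (Multiset.k S) size) → toList π ≡ toList σ → π ≡ σ
      toList-inj π σ e = trans (sym (Vec.cast-is-id refl π)) (Vec.toList-injective refl π σ e)

      to : ∀ {w} → w ∈ map toList words → w ∈ generate mult
      to h with π , π∈ , refl ← ∈-map⁻ toList h
           with π∈′ , av ← ∈-filter⁻ (avoidsAll? P) π∈
           with _ , c ← ∈-filter⁻ (isMultipermutation? S) {xs = allWords (Multiset.k S) size} π∈′
        = ∈-generate⁺ mult 1≤mult (Equivalence.to (avoids⇔ π) av)
            λ i → trans (sym (count≡occ i π)) (c i)

      from : ∀ {w} → w ∈ generate mult → w ∈ map toList words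
      from {w} h with av , c ← ∈-generate⁻ mult 1≤mult h
        = subst (_∈ map toList words) πw (∈-map⁺ toList
            (∈-filter⁺ (avoidsAll? P)
              (∈-filter⁺ (isMultipermutation? S) (∈-allWords π)
                λ i → trans (count≡occ i π) (trans (cong (occ i) πw) (c i)))
              (Equivalence.from (avoids⇔ π) (subst Avoid (sym πw) av))))
        where
        π : Word (Multiset.k S) size
        -- Generated words carry no length index; the content of `w` forces its length to be `size`.
        π = Vec.cast (content-length mult w c) (Vec.fromList w)

        πw : toList π ≡ w
        πw = trans (Vec.toList-cast (content-length mult w c) (Vec.fromList w))
          (Vec.toList∘fromList w)

-- Sortedness through sublists, and words with all zeros at one end

module _ {R : Rel A 0ℓ} where
  allPairs⁺ : ∀ {v} → (∀ {y z} → y ∷ z ∷ [] ⊆ v → R y z) → AllPairs R v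
  allPairs⁺ {[]}    h = []
  allPairs⁺ {x ∷ v} h = All.tabulate (λ z∈ → h (refl ∷ from∈ z∈)) ∷ allPairs⁺ (h ∘ (x ∷ʳ_))

  allPairs⁻ : ∀ {v y z} → AllPairs R v → y ∷ z ∷ [] ⊆ v → R y z
  allPairs⁻ (_ ∷ ps) (_ ∷ʳ τ)   = allPairs⁻ ps τ
  allPairs⁻ (p ∷ _)  (refl ∷ τ) = All.lookup p (to∈ τ)

no-suc : (w : List (Fin (suc k))) → (∀ {y} → ¬ (suc y ∷ [] ⊆ w)) →
         w ≡ map suc (delete w) ++ replicate (zeros w) zero
no-suc []          h = refl
no-suc (zero ∷ w)  h with delete w in e | no-suc w (h ∘ (zero ∷ʳ_))
... | []    | eq = cong (zero ∷_) eq
... | y ∷ v | eq = contradiction (zero ∷ʳ subst (suc y ∷ [] ⊆_) (sym eq) (refl ∷ minimum _)) h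
no-suc (suc x ∷ w) h = contradiction (refl ∷ minimum w) h

-- From the first zero on no other letter can follow, and `no-suc` applies there. The hypothesis is
-- what avoiding 112 says about the part after a zero.
zeros-last : (w : List (Fin (suc k))) → (∀ {y} → ¬ (zero ∷ suc y ∷ [] ⊆ w)) →
             w ≡ map suc (delete w) ++ replicate (zeros w) zero
zeros-last []          h = refl
zeros-last (zero ∷ w)  h = no-suc (zero ∷ w) λ { (_ ∷ʳ τ) → h (refl ∷ τ) }
zeros-last (suc x ∷ w) h = cong (suc x ∷_) (zeros-last w (h ∘ (suc x ∷ʳ_)))

zeros≡0⇒zero⊈ : ∀ {ys} (w : List (Fin (suc k))) → zeros w ≡ 0 → ¬ (zero ∷ ys ⊆ w)
zeros≡0⇒zero⊈ (suc x ∷ w) z (_ ∷ʳ τ) = zeros≡0⇒zero⊈ w z τ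

no-zero : (w : List (Fin (suc k))) → ¬ (zero ∷ [] ⊆ w) →
          w ≡ replicate (zeros w) zero ++ map suc (delete w)
no-zero []          h = refl
no-zero (zero ∷ w)  h = contradiction (refl ∷ minimum w) h
no-zero (suc x ∷ w) h with zeros w in e | no-zero w (h ∘ (suc x ∷ʳ_))
... | zero  | eq = cong (suc x ∷_) eq
... | suc a | eq = contradiction (suc x ∷ʳ subst (zero ∷ [] ⊆_) (sym eq) (refl ∷ minimum _)) h

-- Leading zeros are peeled off; from the first other letter on, `no-zero` applies. The hypothesis
-- is what avoiding 121 says about the part after a zero.
zeros-first : (w : List (Fin (suc k))) → (∀ {y} → ¬ (suc y ∷ zero ∷ [] ⊆ w)) →
              w ≡ replicate (zeros w) zero ++ map suc (delete w)
zeros-first []          h = refl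
zeros-first (zero ∷ w)  h = cong (zero ∷_) (zeros-first w (h ∘ (zero ∷ʳ_)))
zeros-first (suc x ∷ w) h = no-zero (suc x ∷ w) λ { (_ ∷ʳ τ) → h (refl ∷ τ) }

suc⊈replicate : ∀ a {y : Fin k} {ys} → ¬ (suc y ∷ ys ⊆ replicate a zero)
suc⊈replicate (suc a) (_ ∷ʳ τ) = suc⊈replicate a τ

glueˡ glueʳ : ℕ → List (Fin k) → List (Fin (suc k))
glueˡ a v = replicate a zero ++ map suc v
glueʳ a v = map suc v ++ replicate a zero

delete-glueˡ : ∀ a (v : List (Fin k)) → delete (glueˡ a v) ≡ v
delete-glueˡ zero    v = delete-map-suc v
delete-glueˡ (suc a) v = delete-glueˡ a v

zeros-glueˡ : ∀ a (v : List (Fin k)) → zeros (glueˡ a v) ≡ a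
zeros-glueˡ zero    v = zeros-map-suc v
zeros-glueˡ (suc a) v = cong suc (zeros-glueˡ a v)

delete-glueʳ : ∀ a (v : List (Fin k)) → delete (glueʳ a v) ≡ v
delete-glueʳ zero    []      = refl
delete-glueʳ (suc a) []      = delete-glueʳ a []
delete-glueʳ a       (x ∷ v) = cong (x ∷_) (delete-glueʳ a v)

zeros-glueʳ : ∀ a (v : List (Fin k)) → zeros (glueʳ a v) ≡ a
zeros-glueʳ zero    []      = refl
zeros-glueʳ (suc a) []      = cong suc (zeros-glueʳ a [])
zeros-glueʳ a       (x ∷ v) = zeros-glueʳ a v

zero-suc⊈glueʳ : ∀ a (v : List (Fin k)) {y} → ¬ (zero ∷ suc y ∷ [] ⊆ glueʳ a v)
zero-suc⊈glueʳ a []      τ        = suc⊈replicate a (⊆.∷ˡ⁻ τ)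
zero-suc⊈glueʳ a (x ∷ v) (_ ∷ʳ τ) = zero-suc⊈glueʳ a v τ

suc-zero⊈glueˡ : ∀ a (v : List (Fin k)) {y} → ¬ (suc y ∷ zero ∷ [] ⊆ glueˡ a v)
suc-zero⊈glueˡ zero    v τ        = zeros≡0⇒zero⊈ (map suc v) (zeros-map-suc v) (⊆.∷ˡ⁻ τ)
suc-zero⊈glueˡ (suc a) v (_ ∷ʳ τ) = suc-zero⊈glueˡ a v τ

-- Avoidance is equivalent to being an insertion, for each pair of patterns

module ZerosLast where
  open Insertion _≥_ (λ x y → y Fin.≤? x) glueʳ delete-glueʳ zeros-glueʳ public

  Avoid : List (Fin k) → Set
  Avoid w = Avoid112 w × Avoid1231 w

  avoid-tail : ∀ {x : Fin k} {w} → Avoid (x ∷ w) → Avoid w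
  avoid-tail (av , av′) = (λ x<y → av x<y ∘ (_ ∷ʳ_)) , (λ x<y y<z → av′ x<y y<z ∘ (_ ∷ʳ_))

  avoid-delete : ∀ {w : List (Fin (suc k))} → Avoid w → Avoid (delete w)
  avoid-delete {w = w} (av , av′) =
    (λ x<y → av (s<s x<y) ∘ delete-⊆⁻ w) ,
    (λ x<y y<z → av′ (s<s x<y) (s<s y<z) ∘ delete-⊆⁻ w)

  avoid⇒inserted : ∀ {a} {w : List (Fin (suc k))} →
                   Avoid w → zeros w ≡ suc a → Inserted a (delete w) w
  avoid⇒inserted {w = suc x ∷ w} av z = there (avoid⇒inserted (avoid-tail av) z)
  avoid⇒inserted {w = zero ∷ w} (av , av′) refl =
    subst (Inserted (zeros w) (delete w) ∘ (zero ∷_)) (sym w≡) (here (insertable refl))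
    where
    w≡ : w ≡ glueʳ (zeros w) (delete w)
    w≡ = zeros-last w λ τ → av z<s (refl ∷ τ)

    insertable : ∀ {a} → zeros w ≡ a → Insertable (zeros w) (delete w)
    insertable {zero}  e = inj₁ e
    -- An ascent of B lies between the first zero and a final zero, which makes a 1231.
    insertable {suc a} e = inj₂ (allPairs⁺ λ {y} {z} τ → ℕ.≮⇒≥ λ y<z →
      av′ z<s (s<s y<z) (refl ∷ subst (suc y ∷ suc z ∷ zero ∷ [] ⊆_) (sym w≡)
        (⊆.++⁺ (⊆.map⁺ suc τ)
          (subst (λ b → zero ∷ [] ⊆ replicate b zero) (sym e) (refl ∷ minimum _)))))

  -- An occurrence whose smallest letter is not zero survives deletion and contradicts `Avoid v`.
  -- Otherwise it starts at a zero and the shape of the part after the first zero excludes it.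
  inserted⇒avoid : ∀ {a v} {w : List (Fin (suc k))} → Avoid v → Inserted a v w → Avoid w
  inserted⇒avoid {a = a} {w = w} (av , av′) i = no112 , no1231
    where
    delete-⊆ : ∀ ys → map suc ys ⊆ w → ys ⊆ _
    delete-⊆ ys τ = subst (ys ⊆_) (inserted-delete i) (delete-⊆⁺ ys τ)

    no112 : Avoid112 w
    no112 {suc x} {suc y} x<y τ = av (s<s⁻¹ x<y) (delete-⊆ (x ∷ x ∷ y ∷ []) τ)
    no112 {zero}  {suc y} x<y τ with u , _ , σ ← after-first-zero i τ = zero-suc⊈glueʳ a u σ

    no1231 : Avoid1231 w
    no1231 {suc x} {suc y} {suc z} x<y y<z τ =
      av′ (s<s⁻¹ x<y) (s<s⁻¹ y<z) (delete-⊆ (x ∷ y ∷ z ∷ x ∷ []) τ)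
    no1231 {zero} {suc y} {suc z} x<y y<z τ with after-first-zero i τ
    -- With only one zero in the word, the closing letter of 1231 has no candidate.
    ... | u , inj₁ refl , σ = zeros≡0⇒zero⊈ (glueʳ 0 u) (zeros-glueʳ 0 u) (⊆.∷ˡ⁻ (⊆.∷ˡ⁻ σ))
    ... | u , inj₂ ps , σ = ℕ.<⇒≱ (s<s⁻¹ y<z) (allPairs⁻ ps
      (subst (y ∷ z ∷ [] ⊆_) (delete-glueʳ a u)
        (delete-⊆⁺ (y ∷ z ∷ []) (⊆-trans (refl ∷ refl ∷ minimum _) σ))))

  open Enumeration Avoid ((λ _ ()) , (λ _ _ ())) avoid-delete avoid⇒inserted inserted⇒avoid public

module ZerosFirst where
  open Insertion Fin._≤_ Fin._≤?_ glueˡ delete-glueˡ zeros-glueˡ public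

  Avoid : List (Fin k) → Set
  Avoid w = Avoid121 w × Avoid1132 w

  avoid-tail : ∀ {x : Fin k} {w} → Avoid (x ∷ w) → Avoid w
  avoid-tail (av , av′) = (λ x<y → av x<y ∘ (_ ∷ʳ_)) , (λ x<y y<z → av′ x<y y<z ∘ (_ ∷ʳ_))

  avoid-delete : ∀ {w : List (Fin (suc k))} → Avoid w → Avoid (delete w)
  avoid-delete {w = w} (av , av′) =
    (λ x<y → av (s<s x<y) ∘ delete-⊆⁻ w) ,
    (λ x<y y<z → av′ (s<s x<y) (s<s y<z) ∘ delete-⊆⁻ w)

  avoid⇒inserted : ∀ {a} {w : List (Fin (suc k))} →
                   Avoid w → zeros w ≡ suc a → Inserted a (delete w) w
  avoid⇒inserted {w = suc x ∷ w} av z = there (avoid⇒inserted (avoid-tail av) z)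
  avoid⇒inserted {w = zero ∷ w} (av , av′) refl =
    subst (Inserted (zeros w) (delete w) ∘ (zero ∷_)) (sym w≡) (here (insertable refl))
    where
    w≡ : w ≡ glueˡ (zeros w) (delete w)
    w≡ = zeros-first w λ τ → av z<s (refl ∷ τ)

    insertable : ∀ {a} → zeros w ≡ a → Insertable (zeros w) (delete w)
    insertable {zero}  e = inj₁ e
    -- A descent of B preceded by two zeros makes a 1132.
    insertable {suc a} e = inj₂ (allPairs⁺ λ {y} {z} τ → ℕ.≮⇒≥ λ z<y →
      av′ z<s (s<s z<y) (refl ∷ subst (zero ∷ suc y ∷ suc z ∷ [] ⊆_) (sym w≡)
        (⊆.++⁺ (subst (λ b → zero ∷ [] ⊆ replicate b zero) (sym e) (refl ∷ minimum _))
          (⊆.map⁺ suc τ))))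

  inserted⇒avoid : ∀ {a v} {w : List (Fin (suc k))} → Avoid v → Inserted a v w → Avoid w
  inserted⇒avoid {a = a} {w = w} (av , av′) i = no121 , no1132
    where
    delete-⊆ : ∀ ys → map suc ys ⊆ w → ys ⊆ _
    delete-⊆ ys τ = subst (ys ⊆_) (inserted-delete i) (delete-⊆⁺ ys τ)

    no121 : Avoid121 w
    no121 {suc x} {suc y} x<y τ = av (s<s⁻¹ x<y) (delete-⊆ (x ∷ y ∷ x ∷ []) τ)
    no121 {zero}  {suc y} x<y τ with u , _ , σ ← after-first-zero i τ = suc-zero⊈glueˡ a u σ

    no1132 : Avoid1132 w
    no1132 {suc x} {suc y} {suc z} x<y y<z τ =
      av′ (s<s⁻¹ x<y) (s<s⁻¹ y<z) (delete-⊆ (x ∷ x ∷ z ∷ y ∷ []) τ)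
    no1132 {zero} {suc y} {suc z} x<y y<z τ with after-first-zero i τ
    ... | u , inj₁ refl , σ = zeros≡0⇒zero⊈ (glueˡ 0 u) (zeros-glueˡ 0 u) σ
    ... | u , inj₂ ps , σ = ℕ.<⇒≱ (s<s⁻¹ y<z) (allPairs⁻ ps
      (subst (z ∷ y ∷ [] ⊆_) (delete-glueˡ a u) (delete-⊆⁺ (z ∷ y ∷ []) (⊆.∷ˡ⁻ σ))))

  open Enumeration Avoid ((λ _ ()) , (λ _ _ ())) avoid-delete avoid⇒inserted inserted⇒avoid public

-- Lengths of sorted suffixes before and after an insertion

module _ {R : Rel A 0ℓ} (R? : B.Decidable R) where
  -- Suffixes are tested from the whole word downwards, so the first sorted one found is the
  -- longest.
  runLength : List A → ℕ
  runLength []      = 0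
  runLength (x ∷ w) with allPairs? R? (x ∷ w)
  ... | yes _ = suc (length w)
  ... | no  _ = runLength w

  runLength-yes : ∀ {w} → AllPairs R w → runLength w ≡ length w
  runLength-yes {[]}    _  = refl
  runLength-yes {x ∷ w} ps with allPairs? R? (x ∷ w)
  ... | yes _  = refl
  ... | no ¬ps = contradiction ps ¬ps

  runLength-no : ∀ x w → ¬ AllPairs R (x ∷ w) → runLength (x ∷ w) ≡ runLength w
  runLength-no x w ¬ps with allPairs? R? (x ∷ w)
  ... | yes ps = contradiction ps ¬ps
  ... | no  _  = refl

  runLength≤length : ∀ w → runLength w ≤ length w
  runLength≤length []      = z≤n
  runLength≤length (x ∷ w) with allPairs? R? (x ∷ w)
  ... | yes _ = ℕ.≤-refl
  ... | no  _ = ℕ.m≤n⇒m≤1+n (runLength≤length w)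

module _ {P : Set} {x : A} {xs : List A} where
  prependIf-yes : (d : Dec P) → P → prependIf d x xs ≡ x ∷ xs
  prependIf-yes (yes _) p = refl
  prependIf-yes (no ¬p) p = contradiction p ¬p

  prependIf-no : (d : Dec P) → ¬ P → prependIf d x xs ≡ xs
  prependIf-no (yes p) ¬p = contradiction p ¬p
  prependIf-no (no _)  ¬p = refl

prependIf-∷ʳ : ∀ {P : Set} {x y : A} {xs} (d : Dec P) →
               prependIf d x (xs List.∷ʳ y) ≡ prependIf d x xs List.∷ʳ y
prependIf-∷ʳ (yes _) = refl
prependIf-∷ʳ (no  _) = refl

-- Below, n is the length of a word, l that of its longest sorted suffix, and
-- suc a the number of zeros inserted.
padding : ℕ → ℕ → ℕ → List ℕ
padding zero    n l = replicate (n ℕ.∸ l) l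
padding (suc _) n l = []

padding-n-n : ∀ a n → padding a n n ≡ []
padding-n-n zero    n = cong (λ d → replicate d n) (ℕ.n∸n≡0 n)
padding-n-n (suc a) n = refl

padding-suc : ∀ {n l} → l ≤ n → padding 0 (suc n) l ≡ l ∷ padding 0 n l
padding-suc {l = l} l≤n = cong (λ d → replicate d l) (ℕ.+-∸-assoc 1 l≤n)

-- The succession rule of both trees, for multiplicity `suc a`. The order is that of
-- `ZerosFirst.insertions`, where B shrinks from the whole word to the empty one: first the unsorted
-- B, then the sorted ones.
insertionRuns : ℕ → ℕ → ℕ → List ℕ
insertionRuns a n l = padding a n l ++ map (suc a +_) (downFrom (suc l))

insertionRuns-full : ∀ a n → (suc a + suc n) ∷ insertionRuns a n n ≡ insertionRuns a (suc n) (suc n)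
insertionRuns-full a n = trans
  (cong (λ p → (suc a + suc n) ∷ p ++ map (suc a +_) (downFrom (suc n))) (padding-n-n a n))
  (cong (_++ map (suc a +_) (downFrom (suc (suc n)))) (sym (padding-n-n a (suc n))))

-- `insertionRuns` without its value `suc a + l`. A nonempty sorted B gives `a` plus its length,
-- since the first zero is cut off; these are the values from `a + l` down to `suc a`.
innerRuns : ℕ → ℕ → ℕ → List ℕ
innerRuns a n l = padding a n l ++ map (suc a +_) (downFrom l)

innerRuns-full : ∀ a n → (a + suc n) ∷ innerRuns a n n ≡ innerRuns a (suc n) (suc n)
innerRuns-full a n = trans
  (cong₂ (λ r p → r ∷ p ++ map (suc a +_) (downFrom n)) (ℕ.+-suc a n) (padding-n-n a n))
  (cong (_++ map (suc a +_) (downFrom (suc n))) (sym (padding-n-n a (suc n))))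

-- With weakly decreasing suffixes the value `suc a + l` belongs to the empty B, the last insertion
-- listed. With increasing ones it belongs to the longest sorted B, right after the padding.
innerRuns∷ʳ↭insertionRuns : ∀ a n l → innerRuns a n l List.∷ʳ (suc a + l) ↭ insertionRuns a n l
innerRuns∷ʳ↭insertionRuns a n l = ↭-trans
  (↭-reflexive (List.++-assoc (padding a n l) (map (suc a +_) (downFrom l)) _))
  (↭.++⁺ˡ (padding a n l) (↭-sym (↭.∷↭∷ʳ _ _)))

length-glueˡ : ∀ a (v : List (Fin k)) → length (glueˡ a v) ≡ a + length v
length-glueˡ a v = trans (length-delete (glueˡ a v))
  (cong₂ _+_ (zeros-glueˡ a v) (cong length (delete-glueˡ a v)))

length-glueʳ : ∀ a (v : List (Fin k)) → length (glueʳ a v) ≡ a + length v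
length-glueʳ a v = trans (length-delete (glueʳ a v))
  (cong₂ _+_ (zeros-glueʳ a v) (cong length (delete-glueʳ a v)))


runLength-map-∷ : ∀ {R : Rel A 0ℓ} (R? : B.Decidable R) {x ws} →
                  (∀ {w} → w ∈ ws → ¬ AllPairs R (x ∷ w)) →
                  map (runLength R?) (map (x ∷_) ws) ≡ map (runLength R?) ws
runLength-map-∷ R? {ws = ws} ¬ps = trans (sym (List.map-∘ ws))
  (List.map-cong-local (All.tabulate (runLength-no R? _ _ ∘ ¬ps)))

-- Labels of the children in the two trees

module ZerosFirstRuns where
  open ZerosFirst

  run : List (Fin k) → ℕ
  run = runLength Fin._≤?_

  sorted-glue : ∀ a {v : List (Fin k)} → AllPairs Fin._≤_ v → AllPairs Fin._≤_ (glueˡ a v)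
  sorted-glue zero    ps = AllPairs.map⁺ (AllPairs.map s≤s ps)
  sorted-glue (suc a) ps = All.tabulate (λ _ → z≤n) ∷ sorted-glue a ps

  sorted-delete : ∀ {w : List (Fin (suc k))} → AllPairs Fin._≤_ w → AllPairs Fin._≤_ (delete w)
  sorted-delete {w = w} ps = allPairs⁺ λ τ → ℕ.s≤s⁻¹ (allPairs⁻ ps (delete-⊆⁻ w τ))

  sorted-glue⁻ : ∀ a {v : List (Fin k)} → AllPairs Fin._≤_ (glueˡ a v) → AllPairs Fin._≤_ v
  sorted-glue⁻ a {v} = subst (AllPairs Fin._≤_) (delete-glueˡ a v) ∘ sorted-delete

  run-map-suc : (v : List (Fin k)) → run (map suc v) ≡ run v
  run-map-suc []      = refl
  run-map-suc (x ∷ v) with toSum (allPairs? Fin._≤?_ (x ∷ v))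
  ... | inj₁ ps = trans (runLength-yes _ (sorted-glue 0 ps))
    (trans (List.length-map suc (x ∷ v)) (sym (runLength-yes _ ps)))
  ... | inj₂ ¬ps = trans (runLength-no _ (suc x) (map suc v) (¬ps ∘ sorted-glue⁻ 0))
    (trans (run-map-suc v) (sym (runLength-no _ x v ¬ps)))

  run-glue : ∀ a {v : List (Fin k)} → AllPairs Fin._≤_ v → run (glueˡ a v) ≡ a + length v
  run-glue a {v} ps = trans (runLength-yes _ (sorted-glue a ps)) (length-glueˡ a v)

  -- `w` contains a zero, and the letter just before its first zero makes a descent.
  inserted-unsorted : ∀ {a} {x : Fin k} {v w} → Inserted a v w → ¬ AllPairs Fin._≤_ (suc x ∷ w)
  inserted-unsorted (here _)  ((() ∷ _) ∷ _)
  inserted-unsorted (there i) (_ ∷ ps) = inserted-unsorted i ps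

  -- A new first letter `x` keeps the labels of the old insertions and offers one new insertion, in
  -- front of `x`. If `x ∷ v` is sorted it yields the new largest value; if not, it is one more copy
  -- of `run v` for `a` equal to 0, and not allowed for larger `a`.
  runs : ∀ a (v : List (Fin k)) →
         map run (insertions a v) ≡ insertionRuns a (length v) (run v)
  runs {k} a [] = trans (cong (_∷ []) (run-glue (suc a) {[]} []))
    (cong (_++ (suc a + 0) ∷ []) (sym (padding-n-n a 0)))
  runs a (x ∷ v) = by-cases a (toSum (allPairs? Fin._≤?_ (x ∷ v)))
    (trans (runLength-map-∷ _ (inserted-unsorted ∘ ∈-insertions⁻ a v)) (runs a v))
    where
    open ≡-Reasoning
    ℓ = length v

    by-cases : ∀ a → AllPairs Fin._≤_ (x ∷ v) ⊎ ¬ AllPairs Fin._≤_ (x ∷ v) →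
               map run (map (suc x ∷_) (insertions a v)) ≡ insertionRuns a ℓ (run v) →
               map run (insertions a (x ∷ v)) ≡ insertionRuns a (suc ℓ) (run (x ∷ v))
    by-cases a (inj₁ ps@(_ ∷ ps′)) ih = begin
      map run (insertions a (x ∷ v))
        ≡⟨ cong (map run) (prependIf-yes (insertable? a (x ∷ v)) (inj₂ ps)) ⟩
      run (zero ∷ glueˡ a (x ∷ v)) ∷ map run (map (suc x ∷_) (insertions a v))
        ≡⟨ cong₂ _∷_ (run-glue (suc a) ps) ih ⟩
      (suc a + suc ℓ) ∷ insertionRuns a ℓ (run v)
        ≡⟨ cong (λ l → (suc a + suc ℓ) ∷ insertionRuns a ℓ l) (runLength-yes _ ps′) ⟩
      (suc a + suc ℓ) ∷ insertionRuns a ℓ ℓ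
        ≡⟨ insertionRuns-full a ℓ ⟩
      insertionRuns a (suc ℓ) (suc ℓ)
        ≡⟨ cong (insertionRuns a (suc ℓ)) (runLength-yes _ ps) ⟨
      insertionRuns a (suc ℓ) (run (x ∷ v)) ∎
    by-cases zero (inj₂ ¬ps) ih = begin
      map run (insertions 0 (x ∷ v))
        ≡⟨ cong (map run) (prependIf-yes {x = zero ∷ glueˡ 0 (x ∷ v)}
            (insertable? 0 (x ∷ v)) (inj₁ refl)) ⟩
      run (zero ∷ map suc (x ∷ v)) ∷ map run (map (suc x ∷_) (insertions 0 v))
        ≡⟨ cong₂ _∷_ (runLength-no _ zero (map suc (x ∷ v)) (¬ps ∘ sorted-glue⁻ 1)) ih ⟩
      run (map suc (x ∷ v)) ∷ insertionRuns 0 ℓ (run v)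
        ≡⟨ cong (_∷ _) (trans (run-map-suc (x ∷ v)) (runLength-no _ x v ¬ps)) ⟩
      run v ∷ insertionRuns 0 ℓ (run v)
        ≡⟨ cong (_++ map suc (downFrom (suc (run v)))) (padding-suc (runLength≤length _ v)) ⟨
      insertionRuns 0 (suc ℓ) (run v)
        ≡⟨ cong (insertionRuns 0 (suc ℓ)) (runLength-no _ x v ¬ps) ⟨
      insertionRuns 0 (suc ℓ) (run (x ∷ v)) ∎
    by-cases (suc a) (inj₂ ¬ps) ih = begin
      map run (insertions (suc a) (x ∷ v))
        ≡⟨ cong (map run) (prependIf-no (insertable? (suc a) (x ∷ v)) λ { (inj₂ ps) → ¬ps ps }) ⟩
      map run (map (suc x ∷_) (insertions (suc a) v))
        ≡⟨ ih ⟩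
      insertionRuns (suc a) (suc ℓ) (run v)
        ≡⟨ cong (insertionRuns (suc a) (suc ℓ)) (runLength-no _ x v ¬ps) ⟨
      insertionRuns (suc a) (suc ℓ) (run (x ∷ v)) ∎

module ZerosLastRuns where
  open ZerosLast

  _≥?_ : (x y : Fin k) → Dec (x ≥ y)
  x ≥? y = y Fin.≤? x

  run : List (Fin k) → ℕ
  run = runLength _≥?_

  sorted-replicate : ∀ a → AllPairs (_≥_ {suc k}) (replicate a zero)
  sorted-replicate zero    = []
  sorted-replicate (suc a) = All.replicate⁺ a z≤n ∷ sorted-replicate a

  sorted-glue : ∀ a {v : List (Fin k)} → AllPairs _≥_ v → AllPairs _≥_ (glueʳ a v)
  sorted-glue a {v} ps = AllPairs.++⁺ (AllPairs.map⁺ (AllPairs.map s≤s ps)) (sorted-replicate a)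
    (All.tabulate λ _ → All.replicate⁺ a z≤n)

  sorted-delete : ∀ {w : List (Fin (suc k))} → AllPairs _≥_ w → AllPairs _≥_ (delete w)
  sorted-delete {w = w} ps = allPairs⁺ λ τ → ℕ.s≤s⁻¹ (allPairs⁻ ps (delete-⊆⁻ w τ))

  sorted-glue⁻ : ∀ a {v : List (Fin k)} → AllPairs _≥_ (glueʳ a v) → AllPairs _≥_ v
  sorted-glue⁻ a {v} = subst (AllPairs _≥_) (delete-glueʳ a v) ∘ sorted-delete

  -- Final zeros lie below every letter, so they prolong the weakly decreasing suffix whether or not
  -- `v` itself is sorted.
  run-glue : ∀ a (v : List (Fin k)) → run (glueʳ a v) ≡ a + run v
  run-glue a []      = trans (runLength-yes _≥?_ (sorted-glue a [])) (length-glueʳ a [])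
  run-glue a (x ∷ v) with toSum (allPairs? _≥?_ (x ∷ v))
  ... | inj₁ ps = trans (runLength-yes _≥?_ (sorted-glue a ps))
    (trans (length-glueʳ a (x ∷ v)) (cong (a +_) (sym (runLength-yes _≥?_ ps))))
  ... | inj₂ ¬ps = trans (runLength-no _≥?_ (suc x) (glueʳ a v) (¬ps ∘ sorted-glue⁻ a))
    (trans (run-glue a v) (cong (a +_) (sym (runLength-no _≥?_ x v ¬ps))))

  -- The insertions with a letter of v after the first zero.
  inner : ℕ → List (Fin k) → List (List (Fin (suc k)))
  inner a []      = []
  inner a (x ∷ v) =
    prependIf (insertable? a (x ∷ v)) (zero ∷ glueʳ a (x ∷ v)) (map (suc x ∷_) (inner a v))

  -- The last insertion has B empty and all `suc a` zeros at the end. It is set apart because only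
  -- there does the decreasing suffix contain the first zero.
  insertions≡inner∷ʳ : ∀ a (v : List (Fin k)) → insertions a v ≡ inner a v List.∷ʳ glueʳ (suc a) v
  insertions≡inner∷ʳ a []      = refl
  insertions≡inner∷ʳ a (x ∷ v) = trans
    (cong (prependIf d _) (trans (cong (map (suc x ∷_)) (insertions≡inner∷ʳ a v))
      (List.map-++ (suc x ∷_) (inner a v) _)))
    (prependIf-∷ʳ d)
    where d = insertable? a (x ∷ v)

  -- This ascent starts at the first zero, so no decreasing suffix reaches it or any letter before
  -- it.
  inner-ascent : ∀ a (v : List (Fin k)) {w} → w ∈ inner a v → ∃ λ y → zero ∷ suc y ∷ [] ⊆ w
  inner-ascent a (x ∷ v) h with ∈-prependIf⁻ (insertable? a (x ∷ v)) h
  ... | inj₁ (_ , refl) = x , refl ∷ refl ∷ minimum _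
  ... | inj₂ h′ with w , w∈ , refl ← ∈-map⁻ (suc x ∷_) h′
                with y , τ ← inner-ascent a v w∈ = y , (_ ∷ʳ τ)

  inner-unsorted : ∀ a (v : List (Fin k)) {x w} → w ∈ inner a v → ¬ AllPairs _≥_ (x ∷ w)
  inner-unsorted a v w∈ (_ ∷ ps) with y , τ ← inner-ascent a v w∈ = ℕ.n≮0 (allPairs⁻ ps τ)

  ¬sorted-zero∷suc : ∀ {x : Fin k} {w} → ¬ AllPairs _≥_ (zero ∷ suc x ∷ w)
  ¬sorted-zero∷suc ((() ∷ _) ∷ _)

  run-zero∷glue : ∀ a x (v : List (Fin k)) → run (zero ∷ glueʳ a (x ∷ v)) ≡ a + run (x ∷ v)
  run-zero∷glue a x v = trans (runLength-no _≥?_ zero (glueʳ a (x ∷ v)) ¬sorted-zero∷suc)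
    (run-glue a (x ∷ v))

  inner-runs : ∀ a (v : List (Fin k)) → map run (inner a v) ≡ innerRuns a (length v) (run v)
  inner-runs a [] = cong (_++ []) (sym (padding-n-n a 0))
  inner-runs a (x ∷ v) = by-cases a (toSum (allPairs? _≥?_ (x ∷ v)))
    (trans (runLength-map-∷ _≥?_ (inner-unsorted a v)) (inner-runs a v))
    where
    open ≡-Reasoning
    ℓ = length v

    by-cases : ∀ a → AllPairs _≥_ (x ∷ v) ⊎ ¬ AllPairs _≥_ (x ∷ v) →
               map run (map (suc x ∷_) (inner a v)) ≡ innerRuns a ℓ (run v) →
               map run (inner a (x ∷ v)) ≡ innerRuns a (suc ℓ) (run (x ∷ v))
    by-cases a (inj₁ ps@(_ ∷ ps′)) ih = begin
      map run (inner a (x ∷ v))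
        ≡⟨ cong (map run) (prependIf-yes (insertable? a (x ∷ v)) (inj₂ ps)) ⟩
      run (zero ∷ glueʳ a (x ∷ v)) ∷ map run (map (suc x ∷_) (inner a v))
        -- The summand is `a`, not `suc a` as for increasing suffixes: the first zero does not
        -- count.
        ≡⟨ cong₂ _∷_ (run-zero∷glue a x v) ih ⟩
      (a + run (x ∷ v)) ∷ innerRuns a ℓ (run v)
        ≡⟨ cong₂ (λ l l′ → (a + l) ∷ innerRuns a ℓ l′)
             (runLength-yes _≥?_ ps) (runLength-yes _≥?_ ps′) ⟩
      (a + suc ℓ) ∷ innerRuns a ℓ ℓ
        ≡⟨ innerRuns-full a ℓ ⟩
      innerRuns a (suc ℓ) (suc ℓ)
        ≡⟨ cong (innerRuns a (suc ℓ)) (runLength-yes _≥?_ ps) ⟨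
      innerRuns a (suc ℓ) (run (x ∷ v)) ∎
    by-cases zero (inj₂ ¬ps) ih = begin
      map run (inner 0 (x ∷ v))
        ≡⟨ cong (map run) (prependIf-yes {x = zero ∷ glueʳ 0 (x ∷ v)}
            (insertable? 0 (x ∷ v)) (inj₁ refl)) ⟩
      run (zero ∷ glueʳ 0 (x ∷ v)) ∷ map run (map (suc x ∷_) (inner 0 v))
        ≡⟨ cong₂ _∷_ (trans (run-zero∷glue 0 x v) (runLength-no _≥?_ x v ¬ps)) ih ⟩
      run v ∷ innerRuns 0 ℓ (run v)
        ≡⟨ cong (_++ map suc (downFrom (run v))) (padding-suc (runLength≤length _≥?_ v)) ⟨
      innerRuns 0 (suc ℓ) (run v)
        ≡⟨ cong (innerRuns 0 (suc ℓ)) (runLength-no _≥?_ x v ¬ps) ⟨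
      innerRuns 0 (suc ℓ) (run (x ∷ v)) ∎
    by-cases (suc a) (inj₂ ¬ps) ih = begin
      map run (inner (suc a) (x ∷ v))
        ≡⟨ cong (map run) (prependIf-no (insertable? (suc a) (x ∷ v)) λ { (inj₂ ps) → ¬ps ps }) ⟩
      map run (map (suc x ∷_) (inner (suc a) v))
        ≡⟨ ih ⟩
      innerRuns (suc a) (suc ℓ) (run v)
        ≡⟨ cong (innerRuns (suc a) (suc ℓ)) (runLength-no _≥?_ x v ¬ps) ⟨
      innerRuns (suc a) (suc ℓ) (run (x ∷ v)) ∎

  runs : ∀ a (v : List (Fin k)) →
         map run (insertions a v) ↭ insertionRuns a (length v) (run v)
  runs a v = ↭-trans (↭-reflexive split) (innerRuns∷ʳ↭insertionRuns a (length v) (run v))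
    where
    open ≡-Reasoning
    split : map run (insertions a v) ≡ innerRuns a (length v) (run v) List.∷ʳ (suc a + run v)
    split = begin
      map run (insertions a v)
        ≡⟨ cong (map run) (insertions≡inner∷ʳ a v) ⟩
      map run (inner a v List.∷ʳ glueʳ (suc a) v)
        ≡⟨ List.map-++ run (inner a v) _ ⟩
      map run (inner a v) List.∷ʳ run (glueʳ (suc a) v)
        ≡⟨ cong₂ List._∷ʳ_ (inner-runs a v) (run-glue (suc a) v) ⟩
      innerRuns a (length v) (run v) List.∷ʳ (suc a + run v) ∎

-- Comparing the two generating trees level by level

concatMap-↭ : (f : A → List B) → ∀ {xs ys} → xs ↭ ys → concatMap f xs ↭ concatMap f ys
concatMap-↭ f ↭.refl        = ↭.refl
concatMap-↭ f (prep x p)      = ↭.++⁺ˡ (f x) (concatMap-↭ f p)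
concatMap-↭ f (swap x y p)    = ↭-trans (↭.shifts (f x) (f y))
  (↭.++⁺ˡ (f y) (↭.++⁺ˡ (f x) (concatMap-↭ f p)))
concatMap-↭ f (↭.trans p q) = ↭-trans (concatMap-↭ f p) (concatMap-↭ f q)

-- The use of a succession rule `g`: when the labels of the children depend only on the label of the
-- parent, the labels of a level determine those of the next, up to order.
map-concatMap-↭ : ∀ {C D : Set} {f : A → List B} {s : B → C} {t : A → D} (g : D → List C) xs →
                  (∀ {x} → x ∈ xs → map s (f x) ↭ g (t x)) →
                  map s (concatMap f xs) ↭ concatMap g (map t xs)
map-concatMap-↭ g [] h = ↭.refl
map-concatMap-↭ {f = f} {s = s} g (x ∷ xs) h =
  ↭-trans (↭-reflexive (List.map-++ s (f x) (concatMap f xs)))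
    (↭.++⁺ (h (here refl)) (map-concatMap-↭ g xs (h ∘ there)))

-- Equality of the numbers of words alone would not carry through the induction, since the number of
-- children depends on the label.
runs-↭ : (m : Vec ℕ k) → (∀ i → 1 ≤ lookup m i) →
         map ZerosLastRuns.run (ZerosLast.generate m) ↭
         map ZerosFirstRuns.run (ZerosFirst.generate m)
runs-↭ []      pos = ↭.refl
runs-↭ (a ∷ m) pos =
  ↭-trans (map-concatMap-↭ step (ZerosLast.generate m) runsʳ)
    (↭-trans (concatMap-↭ step (runs-↭ m (pos ∘ suc)))
      (↭-sym (map-concatMap-↭ step (ZerosFirst.generate m) runsˡ)))
  where
  step : ℕ → List ℕ
  -- The rule also depends on the word length, but this is `sum m` for every word of the level, so
  -- the suffix length suffices as a label. `pred a` counts the zeros beyond the first.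
  step = insertionRuns (ℕ.pred a) (sum m)

  runsʳ : ∀ {v} → v ∈ ZerosLast.generate m →
          map ZerosLastRuns.run (ZerosLast.insertions (ℕ.pred a) v) ↭ step (ZerosLastRuns.run v)
  runsʳ {v} v∈ = subst (λ n → _ ↭ insertionRuns _ n _)
    (content-length m v (proj₂ (ZerosLast.∈-generate⁻ m (pos ∘ suc) v∈)))
    (ZerosLastRuns.runs (ℕ.pred a) v)

  runsˡ : ∀ {v} → v ∈ ZerosFirst.generate m →
          map ZerosFirstRuns.run (ZerosFirst.insertions (ℕ.pred a) v) ↭ step (ZerosFirstRuns.run v)
  runsˡ {v} v∈ = subst (λ n → _ ↭ insertionRuns _ n _)
    (content-length m v (proj₂ (ZerosFirst.∈-generate⁻ m (pos ∘ suc) v∈)))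
    (↭-reflexive (ZerosFirstRuns.runs (ℕ.pred a) v))

avoids-pair : ∀ {n} {P Q : Pattern} {A B : Set} (π : Word k n) →
              Avoids π P ⇔ A → Avoids π Q ⇔ B → AvoidsAll (P ∷ Q ∷ []) π ⇔ (A × B)
avoids-pair π e f = mk⇔ (λ { (p ∷ q ∷ []) → Equivalence.to e p , Equivalence.to f q })
  λ (p , q) → Equivalence.from e p ∷ Equivalence.from f q ∷ []

theorem2p16 : ((1 ∷ 1 ∷ 2 ∷ []) ∷ (1 ∷ 2 ∷ 3 ∷ 1 ∷ []) ∷ [])
    ∼ ((1 ∷ 2 ∷ 1 ∷ []) ∷ (1 ∷ 1 ∷ 3 ∷ 2 ∷ []) ∷ [])
theorem2p16 S = begin
  av S (p112 ∷ p1231 ∷ [])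
    ≡⟨ ZerosLast.av≡length-generate _ (λ π → avoids-pair π (avoids112 π) (avoids1231 π)) S ⟩
  length (ZerosLast.generate mult)
    ≡⟨ List.length-map ZerosLastRuns.run (ZerosLast.generate mult) ⟨
  length (map ZerosLastRuns.run (ZerosLast.generate mult))
    ≡⟨ ↭.↭-length (runs-↭ mult 1≤mult) ⟩
  length (map ZerosFirstRuns.run (ZerosFirst.generate mult))
    ≡⟨ List.length-map ZerosFirstRuns.run (ZerosFirst.generate mult) ⟩
  length (ZerosFirst.generate mult)
    ≡⟨ ZerosFirst.av≡length-generate _ (λ π → avoids-pair π (avoids121 π) (avoids1132 π)) S ⟨
  av S (p121 ∷ p1132 ∷ []) ∎
  where
  open ≡-Reasoning
  open Multiset S using (mult; 1≤mult)
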